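{- Let $P$ be the transition matrix of a reversible and ergodic Markov chain on $V=\{1,\dots,N\}$ with stationary distribution $\pi$, and consider any functional-router model for $P$ (any choice of routers $\sigma_v$, $v\in V$) with any initial configuration $\chi^{(0)}$. Then for every $w\in V$, every $T\ge 0$ and every $\gamma$ with $0<\gamma<1/2$, $$\left|\chi^{(T)}_w-\mu^{(T)}_w\right|\le \Psi_\sigma\,\frac{2(1-\gamma)}{1-2\gamma}\,\tau(\gamma)\,\frac{\pi_w}{\pi_{\min}}\,\Delta .$$
   Context: Let $V=\{1,\dots,N\}$ and let $P\in\mathbb{R}_{\ge 0}^{N\times N}$ be a stochastic matrix (entries may be irrational) that is ergodic (irreducible and aperiodic), with unique stationary distribution $\pi$; $\pi_{\min}=\min_{v}\pi_v$. $P$ is reversible if $\pi_uP_{u,v}=\pi_vP_{v,u}$ for all $u,v\in V$. For $v\in V$ let $\mathcal N(v)=\{u\in V: P_{v,u}>0\}$ (which contains $v$ if $P_{v,v}>0$), $\delta(v)=|\mathcal N(v)|$ and $\Delta=\max_v\delta(v)$. The total variation distance is $d_{TV}(\xi,\zeta)=\frac12\|\xi-\zeta\|_1$; the mixing time is $\tau(\varepsilon)=\max_{v\in V}\min\{t\in\mathbb{Z}_{\ge0}: d_{TV}(P^t_{v,\cdot},\pi)\le\varepsilon\}$, where $P^t_{v,\cdot}$ is row $v$ of $P^t$; the mixing rate is $t^*=\tau(1/4)$. A functional-router model consists of functions (routers) $\sigma_v:\mathbb{Z}_{\ge0}\to\mathcal N(v)$ for each $v\in V$. Write $I_{v,u}[z,z')=|\{j\in\{z,\dots,z'-1\}:\sigma_v(j)=u\}|$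 (equal to $0$ if $z'\le z$). Given an initial configuration $\chi^{(0)}\in\mathbb{Z}_{\ge0}^N$ with $\sum_v\chi^{(0)}_v=M$, define recursively $Z^{(t)}_{v,u}=I_{v,u}\big[\sum_{s=0}^{t-1}\chi^{(s)}_v,\ \sum_{s=0}^{t}\chi^{(s)}_v\big)$ and $\chi^{(t+1)}_u=\sum_{v\in V}Z^{(t)}_{v,u}$. Let $\mu^{(0)}=\chi^{(0)}$ and $\mu^{(t)}=\mu^{(0)}P^t$ (row vector times matrix). Define $\Psi_\sigma=\sup_{v\in V,\,u\in\mathcal N(v),\,t\ge0}\big|Z^{(t)}_{v,u}-\chi^{(t)}_vP_{v,u}\big|$. -}

module Defs where

open import Algebra.Bundles using (CommutativeRing)
import Algebra.Properties.CommutativeMonoid.Sum as CommutativeMonoidSum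
import Algebra.Properties.Semiring.Mult as SemiringMult
import Algebra.Properties.Semiring.Sum as SemiringSum
open import Algebra.Structures using (IsCommutativeRing)
open import Data.Bool.Base using (if_then_else_)
open import Data.Fin.Base using (Fin; zero)
open import Data.Fin.Properties using () renaming (_≟_ to _≟ᶠ_)
open import Data.List.Base using (length; filter; applyUpTo; allFin; tabulate)
import Data.List.Extrema as Extrema
import Data.List.Extrema.Nat as ExtremaNat
open import Data.Nat.Base as ℕ using (ℕ; zero; suc)
open import Data.Nat.Divisibility using (_∣_)
open import Data.Nat.Properties using () renaming (+-0-commutativeMonoid to ℕ-+-0-commutativeMonoid)
open import Data.Product.Base using (Σ; Σ-syntax; ∃; ∃-syntax; _×_; _,_; proj₁)
open import Data.Vec.Functional using (Vector)
open import Level using (Level; _⊔_) renaming (suc to lsuc)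
open import Relation.Binary.Bundles using (DecTotalOrder)
open import Relation.Binary.Core using (Rel)
import Relation.Binary.Construct.NonStrictToStrict as NonStrictToStrict
open import Relation.Binary.PropositionalEquality.Core using (_≡_)
open import Relation.Binary.Structures using (IsDecTotalOrder)
open import Relation.Nullary.Decidable.Core using (does)
open import Relation.Nullary.Negation.Core using (¬_)
open import Relation.Unary using (Pred)

module _ {a ℓ} {A : Set a} (_≤_ : Rel A ℓ) where

  IsUpperBound : ∀ {p} → Pred A p → A → Set (a ⊔ ℓ ⊔ p)
  IsUpperBound S b = ∀ x → S x → x ≤ b

  IsSupremum : ∀ {p} → Pred A p → A → Set (a ⊔ ℓ ⊔ p)
  IsSupremum S s = IsUpperBound S s × (∀ b → IsUpperBound S b → s ≤ b)

  IsLeast : ∀ {p} → Pred A p → A → Set (a ⊔ ℓ ⊔ p)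
  IsLeast S m = S m × (∀ x → S x → m ≤ x)

IsGCD : ∀ {p} → Pred ℕ p → ℕ → Set p
IsGCD S d = (∀ t → S t → d ∣ t) × (∀ e → (∀ t → S t → e ∣ t) → e ∣ d)

-- The classical axioms of the real numbers, which determine ℝ up to
-- isomorphism.  The order is decidable and every non-empty predicate with an
-- upper bound has a supremum, as in classical analysis.  Inversion is total;
-- only its value at 0# is left unspecified.
record CompleteOrderedField c ℓ₁ ℓ₂ : Set (lsuc (c ⊔ ℓ₁ ⊔ ℓ₂)) where
  infix  4 _≈_ _≤_
  infixl 6 _+_
  infixl 7 _*_
  infix  8 -_ _⁻¹
  field
    Carrier           : Set c
    _≈_               : Rel Carrier ℓ₁
    _≤_               : Rel Carrier ℓ₂
    _+_ _*_           : Carrier → Carrier → Carrier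
    -_ _⁻¹            : Carrier → Carrier
    0# 1#             : Carrier
    isCommutativeRing : IsCommutativeRing _≈_ _+_ _*_ -_ 0# 1#
    0≉1               : ¬ 0# ≈ 1#
    ⁻¹-cong           : ∀ {x y} → x ≈ y → x ⁻¹ ≈ y ⁻¹
    *-inverseʳ        : ∀ x → ¬ x ≈ 0# → x * x ⁻¹ ≈ 1#
    isDecTotalOrder   : IsDecTotalOrder _≈_ _≤_
    +-monoˡ-≤         : ∀ z {x y} → x ≤ y → x + z ≤ y + z
    *-nonNegative     : ∀ {x y} → 0# ≤ x → 0# ≤ y → 0# ≤ x * y
    complete          : (S : Pred Carrier (c ⊔ ℓ₁ ⊔ ℓ₂)) →
                        ∃ S → ∃ (IsUpperBound _≤_ S) → ∃ (IsSupremum _≤_ S)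

  commutativeRing : CommutativeRing c ℓ₁
  commutativeRing = record { isCommutativeRing = isCommutativeRing }

  decTotalOrder : DecTotalOrder c ℓ₁ ℓ₂
  decTotalOrder = record { isDecTotalOrder = isDecTotalOrder }

  open CommutativeRing commutativeRing public using (_-_; semiring)
  open IsDecTotalOrder isDecTotalOrder public using (_≟_; _≤?_)
  open NonStrictToStrict _≈_ _≤_ public using (_<_; <-decidable)
  open SemiringMult semiring using () renaming (_×_ to _·_)

  infix  4 _<?_
  infixl 7 _/_

  _<?_ = <-decidable _≟_ _≤?_

  _/_ : Carrier → Carrier → Carrier
  x / y = x * y ⁻¹

  fromℕ : ℕ → Carrier
  fromℕ n = n · 1#

  2# : Carrier
  2# = fromℕ 2

  ∣_∣ : Carrier → Carrier
  ∣ x ∣ = if does (0# ≤? x) then x else - x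

module MarkovChain {c ℓ₁ ℓ₂} (ℝ : CompleteOrderedField c ℓ₁ ℓ₂) where
  open CompleteOrderedField ℝ hiding (_≟_)
  open SemiringSum semiring using (sum)

  Matrix : ℕ → Set c
  Matrix N = Fin N → Fin N → Carrier

  -- P ^ t is the t-th power; its row v is the vector (P ^ t) v.
  infixr 8 _^_
  _^_ : ∀ {N} → Matrix N → ℕ → Matrix N
  (P ^ zero)  v u = if does (v ≟ᶠ u) then 1# else 0#
  (P ^ suc t) v u = sum λ x → P v x * (P ^ t) x u

  infixl 7 _*ᴹ_
  _*ᴹ_ : ∀ {N} → Vector Carrier N → Matrix N → Vector Carrier N
  (ξ *ᴹ P) u = sum λ v → ξ v * P v u

  IsDistribution : ∀ {N} → Vector Carrier N → Set (ℓ₁ ⊔ ℓ₂)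
  IsDistribution ξ = (∀ v → 0# ≤ ξ v) × sum ξ ≈ 1#

  IsStochastic : ∀ {N} → Matrix N → Set (ℓ₁ ⊔ ℓ₂)
  IsStochastic P = ∀ v → IsDistribution (P v)

  IsIrreducible : ∀ {N} → Matrix N → Set (ℓ₁ ⊔ ℓ₂)
  IsIrreducible P = ∀ u v → ∃[ t ] 0# < (P ^ t) u v

  IsAperiodic : ∀ {N} → Matrix N → Set (ℓ₁ ⊔ ℓ₂)
  IsAperiodic P = ∀ v → IsGCD (λ t → 1 ℕ.≤ t × 0# < (P ^ t) v v) 1

  IsErgodic : ∀ {N} → Matrix N → Set (ℓ₁ ⊔ ℓ₂)
  IsErgodic P = IsIrreducible P × IsAperiodic P

  IsStationary : ∀ {N} → Matrix N → Vector Carrier N → Set (ℓ₁ ⊔ ℓ₂)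
  IsStationary P π = IsDistribution π × (∀ u → (π *ᴹ P) u ≈ π u)

  IsReversible : ∀ {N} → Matrix N → Vector Carrier N → Set ℓ₁
  IsReversible P π = ∀ u v → π u * P u v ≈ π v * P v u

  minimum : ∀ {n} → Vector Carrier (suc n) → Carrier
  minimum π = Extrema.min (DecTotalOrder.totalOrder decTotalOrder) (π zero) (tabulate π)

  𝒩 : ∀ {N} → Matrix N → Fin N → Set (ℓ₁ ⊔ ℓ₂)
  𝒩 P v = ∃[ u ] 0# < P v u

  δ : ∀ {N} → Matrix N → Fin N → ℕ
  δ {N} P v = length (filter (λ u → 0# <? P v u) (allFin N))

  Δ : ∀ {N} → Matrix N → ℕ
  Δ P = ExtremaNat.max 0 (tabulate (δ P))

  dTV : ∀ {N} → Vector Carrier N → Vector Carrier N → Carrier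
  dTV ξ ζ = 1# / 2# * sum λ v → ∣ ξ v - ζ v ∣

  -- τ(ε) = τ.  Stated as a relation because the minimum ranges over an
  -- unbounded set of times; the maximum over the vertices is computed.
  IsMixingTime : ∀ {N} → Matrix N → Vector Carrier N → Carrier → ℕ → Set ℓ₂
  IsMixingTime {N} P π ε τ =
    Σ[ m ∈ (Fin N → ℕ) ]
      (∀ v → IsLeast ℕ._≤_ (λ t → dTV ((P ^ t) v) π ≤ ε) (m v)) ×
      τ ≡ ExtremaNat.max 0 (tabulate m)

module FunctionalRouter {c ℓ₁ ℓ₂} (ℝ : CompleteOrderedField c ℓ₁ ℓ₂) where
  open CompleteOrderedField ℝ hiding (_≟_)
  open MarkovChain ℝ
  open CommutativeMonoidSum ℕ-+-0-commutativeMonoid using () renaming (sum to sumℕ)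

  Routers : ∀ {N} → Matrix N → Set (ℓ₁ ⊔ ℓ₂)
  Routers P = ∀ v → ℕ → 𝒩 P v

  module _ {N} {P : Matrix N} (σ : Routers P) where

    I : Fin N → Fin N → ℕ → ℕ → ℕ
    I v u z z′ = length (filter (λ j → proj₁ (σ v j) ≟ᶠ u) (applyUpTo (z ℕ.+_) (z′ ℕ.∸ z)))

    -- served χ₀ t v is the sum of χ χ₀ s v over s < t.
    mutual
      χ : Vector ℕ N → ℕ → Vector ℕ N
      χ χ₀ zero    u = χ₀ u
      χ χ₀ (suc t) u = sumℕ λ v → Z χ₀ t v u

      Z : Vector ℕ N → ℕ → Fin N → Fin N → ℕ
      Z χ₀ t v u = I v u (served χ₀ t v) (served χ₀ t v ℕ.+ χ χ₀ t v)

      served : Vector ℕ N → ℕ → Vector ℕ N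
      served χ₀ zero    v = 0
      served χ₀ (suc t) v = served χ₀ t v ℕ.+ χ χ₀ t v

    Discrepancies : Vector ℕ N → Pred Carrier (ℓ₁ ⊔ ℓ₂)
    Discrepancies χ₀ x =
      Σ[ v ∈ Fin N ] Σ[ (u , _) ∈ 𝒩 P v ] Σ[ t ∈ ℕ ]
        x ≈ ∣ fromℕ (Z χ₀ t v u) - fromℕ (χ χ₀ t v) * P v u ∣

    IsΨ : Vector ℕ N → Carrier → Set (c ⊔ ℓ₁ ⊔ ℓ₂)
    IsΨ χ₀ = IsSupremum _≤_ (Discrepancies χ₀)

  μ : ∀ {N} → Matrix N → Vector ℕ N → ℕ → Vector Carrier N
  μ P χ₀ t = (λ v → fromℕ (χ₀ v)) *ᴹ (P ^ t)

{-# OPTIONS --safe #-}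
module Submission where

open import Algebra.Bundles using (CommutativeRing)
import Algebra.Properties.CommutativeMonoid.Sum as CommutativeMonoidSum
import Algebra.Properties.Monoid.Mult as MonoidMult
import Algebra.Properties.Ring as RingProperties
import Algebra.Properties.Semiring.Sum as SemiringSum
import Algebra.Solver.Ring.NaturalCoefficients.Default as SemiringSolver
open import Data.Bool.Base using (true; false; if_then_else_)
open import Data.Fin.Base using (Fin; zero; suc)
open import Data.Fin.Properties using () renaming (_≟_ to _≟ᶠ_)
open import Data.List.Base using (List; []; _∷_; length; filter; tabulate; applyUpTo)
import Data.List.Extrema as Extrema
import Data.List.Extrema.Nat as ExtremaNat
open import Data.List.Properties using (filter-none; length-applyUpTo)
import Data.List.Relation.Unary.All as All
open import Data.List.Relation.Unary.All.Properties using (tabulate⁺; tabulate⁻)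
open import Data.Nat.Base as ℕ using (ℕ; zero; suc)
import Data.Nat.Properties as ℕ
open import Data.Product.Base using (_,_; proj₁; proj₂)
open import Data.Sum.Base using (inj₁; inj₂)
open import Data.Vec.Functional using (Vector)
open import Defs
open import Function.Base using (_∘_; id)
open import Relation.Binary.Bundles using (DecTotalOrder)
open import Relation.Binary.PropositionalEquality.Core as ≡ using (_≡_)
import Relation.Binary.Reasoning.PartialOrder as PartialOrderReasoning
open import Relation.Nullary.Decidable.Core using (Dec; yes; no; does)
open import Relation.Nullary.Negation.Core using (¬_; contradiction)
open import Relation.Unary using (Pred; Decidable)

-- Let e_t = χ^(t+1) − χ^(t) P be the error made by the routers at time t, so that
-- χ^(T) − μ^(T) = Σ_t e_t P^(T−1−t).  Each e_t has total mass 0, so the w-th column of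
-- P^s may be replaced by P^s(u,w) − π_w, and |e_t(u)| ≤ Ψ Δ because, by reversibility, at
-- most Δ vertices route into u.  Reversibility also gives
-- |P^s(u,w) − π_w| = (π_w / π_u) |P^s(w,u) − π_u|, so what remains is Σ_s ‖P^s(w,·) − π‖₁.
-- With q = 2γ this norm is at most 2, at most q once s ≥ τ, and shrinks by the factor q
-- every τ steps; summing the geometric series gives the constant.

-- Order, division and absolute values in an ordered field.

module OrderedField {c ℓ₁ ℓ₂} (ℝ : CompleteOrderedField c ℓ₁ ℓ₂) where
  open CompleteOrderedField ℝ
  open CommutativeRing commutativeRing public
    using ( refl; sym; trans; ring; commutativeSemiring; +-monoid
          ; +-cong; +-congˡ; +-congʳ; +-comm; +-assoc; +-identityˡ; +-identityʳ
          ; -‿cong; -‿inverseˡ; -‿inverseʳ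
          ; *-congˡ; *-congʳ; *-comm; *-assoc; *-identityˡ; *-identityʳ
          ; distribˡ; distribʳ; zeroˡ; zeroʳ)
  open RingProperties ring public
    using (-0#≈0#; -‿involutive; -‿+-comm; -‿distribˡ-*; -‿distribʳ-*)
  open DecTotalOrder decTotalOrder public using (total; poset; totalOrder)
    renaming ( refl to ≤-refl; reflexive to ≤-reflexive; trans to ≤-trans
             ; antisym to ≤-antisym; ≤-respˡ-≈ to ≤-respˡ; ≤-respʳ-≈ to ≤-respʳ)
  open MonoidMult +-monoid using (×-homo-+)
  open SemiringSum semiring public
  open SemiringSolver commutativeSemiring public
    using (Polynomial; solve; con; _:+_; _:*_; _:=_)
  open PartialOrderReasoning poset public

  +-mono-≤ : ∀ {x y u v} → x ≤ y → u ≤ v → x + u ≤ y + v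
  +-mono-≤ {x} {y} {u} {v} x≤y u≤v = begin
    x + u  ≤⟨ +-monoˡ-≤ u x≤y ⟩
    y + u  ≈⟨ +-comm y u ⟩
    u + y  ≤⟨ +-monoˡ-≤ y u≤v ⟩
    v + y  ≈⟨ +-comm v y ⟩
    y + v  ∎

  +-nonNegative : ∀ {x y} → 0# ≤ x → 0# ≤ y → 0# ≤ x + y
  +-nonNegative 0≤x 0≤y = ≤-respˡ (+-identityˡ 0#) (+-mono-≤ 0≤x 0≤y)

  [x-y]+y≈x : ∀ x y → (x - y) + y ≈ x
  [x-y]+y≈x x y = trans (+-assoc x (- y) y) (trans (+-congˡ (-‿inverseˡ y)) (+-identityʳ x))

  [x+y]-y≈x : ∀ x y → (x + y) - y ≈ x
  [x+y]-y≈x x y = trans (+-assoc x y (- y)) (trans (+-congˡ (-‿inverseʳ y)) (+-identityʳ x))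

  telescope : ∀ x y z → (x - y) + (y - z) ≈ x - z
  telescope x y z = trans (sym (+-assoc (x - y) y (- z))) (+-congʳ ([x-y]+y≈x x y))

  x≤y⇒0≤y-x : ∀ {x y} → x ≤ y → 0# ≤ y - x
  x≤y⇒0≤y-x {x} x≤y = ≤-respˡ (-‿inverseʳ x) (+-monoˡ-≤ (- x) x≤y)

  0≤y-x⇒x≤y : ∀ {x y} → 0# ≤ y - x → x ≤ y
  0≤y-x⇒x≤y {x} {y} 0≤y-x = begin
    x            ≈⟨ +-identityˡ x ⟨
    0# + x       ≤⟨ +-monoˡ-≤ x 0≤y-x ⟩
    (y - x) + x  ≈⟨ [x-y]+y≈x y x ⟩
    y            ∎

  x≤y+z⇒x-y≤z : ∀ {x y z} → x ≤ y + z → x - y ≤ z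
  x≤y+z⇒x-y≤z {x} {y} {z} x≤y+z = begin
    x - y        ≤⟨ +-monoˡ-≤ (- y) x≤y+z ⟩
    (y + z) - y  ≈⟨ +-congʳ (+-comm y z) ⟩
    (z + y) - y  ≈⟨ [x+y]-y≈x z y ⟩
    z            ∎

  x≤0⇒0≤-x : ∀ {x} → x ≤ 0# → 0# ≤ - x
  x≤0⇒0≤-x {x} x≤0 = ≤-respʳ (+-identityˡ (- x)) (x≤y⇒0≤y-x x≤0)

  0≤x⇒-x≤0 : ∀ {x} → 0# ≤ x → - x ≤ 0#
  0≤x⇒-x≤0 {x} 0≤x = 0≤y-x⇒x≤y (≤-respʳ (sym (trans (+-identityˡ _) (-‿involutive x))) 0≤x)

  *-distribˡ-- : ∀ x y z → x * (y - z) ≈ x * y - x * z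
  *-distribˡ-- x y z = trans (distribˡ x y (- z)) (+-congˡ (sym (-‿distribʳ-* x z)))

  *-distribʳ-- : ∀ x y z → (y - z) * x ≈ y * x - z * x
  *-distribʳ-- x y z = trans (distribʳ x y (- z)) (+-congˡ (sym (-‿distribˡ-* z x)))

  *-monoˡ-≤ : ∀ {x y z} → 0# ≤ z → x ≤ y → z * x ≤ z * y
  *-monoˡ-≤ {x} {y} {z} 0≤z x≤y =
    0≤y-x⇒x≤y (≤-respʳ (*-distribˡ-- z y x) (*-nonNegative 0≤z (x≤y⇒0≤y-x x≤y)))

  *-monoʳ-≤ : ∀ {x y z} → 0# ≤ z → x ≤ y → x * z ≤ y * z
  *-monoʳ-≤ {x} {y} {z} 0≤z x≤y = begin
    x * z  ≈⟨ *-comm x z ⟩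
    z * x  ≤⟨ *-monoˡ-≤ 0≤z x≤y ⟩
    z * y  ≈⟨ *-comm z y ⟩
    y * z  ∎

  -- If `1#` were nonpositive, then `- 1#` would be nonnegative, and so would its square, which is
  -- `1#`.
  0≤1 : 0# ≤ 1#
  0≤1 with total 0# 1#
  ... | inj₁ 0≤1 = 0≤1
  ... | inj₂ 1≤0 = ≤-respʳ [-1][-1]≈1 (*-nonNegative (x≤0⇒0≤-x 1≤0) (x≤0⇒0≤-x 1≤0))
    where
    [-1][-1]≈1 : - 1# * - 1# ≈ 1#
    [-1][-1]≈1 = begin-equality
      - 1# * - 1#      ≈⟨ -‿distribˡ-* 1# (- 1#) ⟨
      - (1# * - 1#)    ≈⟨ -‿cong (*-identityˡ (- 1#)) ⟩
      - (- 1#)         ≈⟨ -‿involutive 1# ⟩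
      1#               ∎

  0<x⇒x≉0 : ∀ {x} → 0# < x → ¬ x ≈ 0#
  0<x⇒x≉0 (_ , 0≉x) x≈0 = 0≉x (sym x≈0)

  0≤x∧x≉0⇒0<x : ∀ {x} → 0# ≤ x → ¬ x ≈ 0# → 0# < x
  0≤x∧x≉0⇒0<x 0≤x x≉0 = 0≤x , λ 0≈x → x≉0 (sym 0≈x)

  x*y/y≈x : ∀ {x y} → ¬ y ≈ 0# → x * y / y ≈ x
  x*y/y≈x {x} {y} y≉0 =
    trans (*-assoc x y (y ⁻¹)) (trans (*-congˡ (*-inverseʳ y y≉0)) (*-identityʳ x))

  x*y≈0∧y≉0⇒x≈0 : ∀ {x y} → x * y ≈ 0# → ¬ y ≈ 0# → x ≈ 0#
  x*y≈0∧y≉0⇒x≈0 {x} {y} xy≈0 y≉0 = begin-equality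
    x          ≈⟨ x*y/y≈x y≉0 ⟨
    x * y / y  ≈⟨ *-congʳ xy≈0 ⟩
    0# / y     ≈⟨ zeroˡ (y ⁻¹) ⟩
    0#         ∎

  ⁻¹-nonNegative : ∀ {x} → 0# < x → 0# ≤ x ⁻¹
  ⁻¹-nonNegative {x} 0<x@(0≤x , _) with total 0# (x ⁻¹)
  ... | inj₁ 0≤x⁻¹ = 0≤x⁻¹
  ... | inj₂ x⁻¹≤0 = contradiction (≤-antisym 0≤1 1≤0) 0≉1
    where
    1≤0 : 1# ≤ 0#
    1≤0 = 0≤y-x⇒x≤y (begin
      0#            ≤⟨ *-nonNegative 0≤x (x≤0⇒0≤-x x⁻¹≤0) ⟩
      x * - (x ⁻¹)  ≈⟨ -‿distribʳ-* x (x ⁻¹) ⟨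
      - (x / x)     ≈⟨ -‿cong (*-inverseʳ x (0<x⇒x≉0 0<x)) ⟩
      - 1#          ≈⟨ +-identityˡ (- 1#) ⟨
      0# - 1#       ∎)

  x*y≤z⇒x≤z/y : ∀ {x y z} → 0# < y → x * y ≤ z → x ≤ z / y
  x*y≤z⇒x≤z/y {x} {y} {z} 0<y xy≤z = begin
    x          ≈⟨ x*y/y≈x (0<x⇒x≉0 0<y) ⟨
    x * y / y  ≤⟨ *-monoʳ-≤ (⁻¹-nonNegative 0<y) xy≤z ⟩
    z / y      ∎

  -- Strictness means `≤` together with `≉`, so the two halves are proved separately. With `y` equal
  -- to `2#` this makes the denominator of the final constant positive.
  x<1/y⇒0<1-y*x : ∀ {x y} → 0# < y → x < 1# / y → 0# < 1# - y * x
  x<1/y⇒0<1-y*x {x} {y} 0<y@(0≤y , _) (x≤1/y , x≉1/y) =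
    0≤x∧x≉0⇒0<x (x≤y⇒0≤y-x yx≤1) λ 1-yx≈0 → x≉1/y (begin-equality
      x           ≈⟨ x*y/y≈x y≉0 ⟨
      x * y / y   ≈⟨ *-congʳ (begin-equality
        x * y                 ≈⟨ *-comm x y ⟩
        y * x                 ≈⟨ +-identityˡ (y * x) ⟨
        0# + y * x            ≈⟨ +-congʳ 1-yx≈0 ⟨
        (1# - y * x) + y * x  ≈⟨ [x-y]+y≈x 1# (y * x) ⟩
        1#                    ∎) ⟩
      1# / y      ∎)
    where
    y≉0 = 0<x⇒x≉0 0<y
    yx≤1 : y * x ≤ 1#
    yx≤1 = begin
      y * x         ≤⟨ *-monoˡ-≤ 0≤y x≤1/y ⟩
      y * (1# / y)  ≈⟨ *-congˡ (*-identityˡ (y ⁻¹)) ⟩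
      y / y         ≈⟨ *-inverseʳ y y≉0 ⟩
      1#            ∎

  fromℕ-+ : ∀ m n → fromℕ (m ℕ.+ n) ≈ fromℕ m + fromℕ n
  fromℕ-+ = ×-homo-+ 1#

  fromℕ-nonNegative : ∀ n → 0# ≤ fromℕ n
  fromℕ-nonNegative zero    = ≤-refl
  fromℕ-nonNegative (suc n) = +-nonNegative 0≤1 (fromℕ-nonNegative n)

  fromℕ-mono-≤ : ∀ {m n} → m ℕ.≤ n → fromℕ m ≤ fromℕ n
  fromℕ-mono-≤ {n = n} ℕ.z≤n = fromℕ-nonNegative n
  fromℕ-mono-≤ (ℕ.s≤s m≤n)   = +-mono-≤ ≤-refl (fromℕ-mono-≤ m≤n)

  0<2 : 0# < 2#
  0<2 = fromℕ-nonNegative 2 , λ 0≈2 → 0≉1 (≤-antisym 0≤1 (begin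
    1#              ≈⟨ +-identityʳ 1# ⟨
    1# + 0#         ≤⟨ +-mono-≤ ≤-refl (fromℕ-nonNegative 1) ⟩
    2#              ≈⟨ 0≈2 ⟨
    0#              ∎))

  0≤x⇒∣x∣≈x : ∀ {x} → 0# ≤ x → ∣ x ∣ ≈ x
  0≤x⇒∣x∣≈x {x} 0≤x with 0# ≤? x
  ... | yes _   = refl
  ... | no  0≰x = contradiction 0≤x 0≰x

  x≤0⇒∣x∣≈-x : ∀ {x} → x ≤ 0# → ∣ x ∣ ≈ - x
  x≤0⇒∣x∣≈-x {x} x≤0 with 0# ≤? x
  -- Here `x` is both nonnegative and nonpositive, hence zero, and the two branches of `∣_∣` agree.
  ... | yes 0≤x = trans x≈0 (sym (trans (-‿cong x≈0) -0#≈0#))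
    where x≈0 = ≤-antisym x≤0 0≤x
  ... | no  _   = refl

  ∣∣-nonNegative : ∀ x → 0# ≤ ∣ x ∣
  ∣∣-nonNegative x with total 0# x
  ... | inj₁ 0≤x = ≤-respʳ (sym (0≤x⇒∣x∣≈x 0≤x)) 0≤x
  ... | inj₂ x≤0 = ≤-respʳ (sym (x≤0⇒∣x∣≈-x x≤0)) (x≤0⇒0≤-x x≤0)

  x≤∣x∣ : ∀ x → x ≤ ∣ x ∣
  x≤∣x∣ x with total 0# x
  ... | inj₁ 0≤x = ≤-reflexive (sym (0≤x⇒∣x∣≈x 0≤x))
  ... | inj₂ x≤0 = ≤-trans x≤0 (∣∣-nonNegative x)

  -x≤∣x∣ : ∀ x → - x ≤ ∣ x ∣
  -x≤∣x∣ x with total 0# x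
  ... | inj₁ 0≤x = ≤-trans (0≤x⇒-x≤0 0≤x) (∣∣-nonNegative x)
  ... | inj₂ x≤0 = ≤-reflexive (sym (x≤0⇒∣x∣≈-x x≤0))

  ∣∣-lub : ∀ {x y} → x ≤ y → - x ≤ y → ∣ x ∣ ≤ y
  ∣∣-lub {x} x≤y -x≤y with total 0# x
  ... | inj₁ 0≤x = ≤-respˡ (sym (0≤x⇒∣x∣≈x 0≤x)) x≤y
  ... | inj₂ x≤0 = ≤-respˡ (sym (x≤0⇒∣x∣≈-x x≤0)) -x≤y

  -- The Boolean test inside `∣_∣` is avoided: `∣ y ∣` bounds `y` and `- y`, hence also `x` and
  -- `- x`, and antisymmetry finishes.
  ∣∣-cong : ∀ {x y} → x ≈ y → ∣ x ∣ ≈ ∣ y ∣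
  ∣∣-cong x≈y = ≤-antisym (half x≈y) (half (sym x≈y))
    where
    half : ∀ {x y} → x ≈ y → ∣ x ∣ ≤ ∣ y ∣
    half {y = y} x≈y = ∣∣-lub (≤-respˡ (sym x≈y) (x≤∣x∣ y)) (≤-respˡ (-‿cong (sym x≈y)) (-x≤∣x∣ y))

  ∣-x∣≈∣x∣ : ∀ x → ∣ - x ∣ ≈ ∣ x ∣
  ∣-x∣≈∣x∣ x = ≤-antisym (half x) (≤-respˡ (∣∣-cong (-‿involutive x)) (half (- x)))
    where
    half : ∀ x → ∣ - x ∣ ≤ ∣ x ∣
    half x = ∣∣-lub (-x≤∣x∣ x) (≤-respˡ (sym (-‿involutive x)) (x≤∣x∣ x))

  ∣x+y∣≤∣x∣+∣y∣ : ∀ x y → ∣ x + y ∣ ≤ ∣ x ∣ + ∣ y ∣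
  ∣x+y∣≤∣x∣+∣y∣ x y = ∣∣-lub (+-mono-≤ (x≤∣x∣ x) (x≤∣x∣ y))
    (≤-respˡ (-‿+-comm x y) (+-mono-≤ (-x≤∣x∣ x) (-x≤∣x∣ y)))

  0≤x⇒∣x*y∣≈x*∣y∣ : ∀ {x} y → 0# ≤ x → ∣ x * y ∣ ≈ x * ∣ y ∣
  0≤x⇒∣x*y∣≈x*∣y∣ {x} y 0≤x with total 0# y
  ... | inj₁ 0≤y = trans (0≤x⇒∣x∣≈x (*-nonNegative 0≤x 0≤y)) (*-congˡ (sym (0≤x⇒∣x∣≈x 0≤y)))
  ... | inj₂ y≤0 = begin-equality
    ∣ x * y ∣   ≈⟨ x≤0⇒∣x∣≈-x (≤-respʳ (zeroʳ x) (*-monoˡ-≤ 0≤x y≤0)) ⟩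
    - (x * y)   ≈⟨ -‿distribʳ-* x y ⟩
    x * - y     ≈⟨ *-congˡ (x≤0⇒∣x∣≈-x y≤0) ⟨
    x * ∣ y ∣   ∎

  ∣x*y∣≈∣x∣*∣y∣ : ∀ x y → ∣ x * y ∣ ≈ ∣ x ∣ * ∣ y ∣
  ∣x*y∣≈∣x∣*∣y∣ x y with total 0# x
  ... | inj₁ 0≤x = trans (0≤x⇒∣x*y∣≈x*∣y∣ y 0≤x) (*-congʳ (sym (0≤x⇒∣x∣≈x 0≤x)))
  ... | inj₂ x≤0 = begin-equality
    ∣ x * y ∣      ≈⟨ ∣-x∣≈∣x∣ (x * y) ⟨
    ∣ - (x * y) ∣  ≈⟨ ∣∣-cong (-‿distribˡ-* x y) ⟩
    ∣ - x * y ∣    ≈⟨ 0≤x⇒∣x*y∣≈x*∣y∣ y (x≤0⇒0≤-x x≤0) ⟩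
    - x * ∣ y ∣    ≈⟨ *-congʳ (x≤0⇒∣x∣≈-x x≤0) ⟨
    ∣ x ∣ * ∣ y ∣  ∎

-- Finite sums, partial sums and a geometric estimate.

module Sums {c ℓ₁ ℓ₂} (ℝ : CompleteOrderedField c ℓ₁ ℓ₂) where
  open CompleteOrderedField ℝ
  open OrderedField ℝ
  open CommutativeMonoidSum ℕ.+-0-commutativeMonoid using () renaming (sum to sumℕ)

  sum-mono-≤ : ∀ {n} {f g : Vector Carrier n} → (∀ i → f i ≤ g i) → sum f ≤ sum g
  sum-mono-≤ {zero}  f≤g = ≤-refl
  sum-mono-≤ {suc n} f≤g = +-mono-≤ (f≤g zero) (sum-mono-≤ (f≤g ∘ suc))

  sum-zero : ∀ {n} {f : Vector Carrier n} → (∀ i → f i ≈ 0#) → sum f ≈ 0#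
  sum-zero {n} f≈0 = trans (sum-cong-≋ f≈0) (sum-replicate-zero n)

  sum-nonNegative : ∀ {n} {f : Vector Carrier n} → (∀ i → 0# ≤ f i) → 0# ≤ sum f
  sum-nonNegative {n} 0≤f = ≤-respˡ (sum-replicate-zero n) (sum-mono-≤ 0≤f)

  sum-neg : ∀ {n} (f : Vector Carrier n) → sum (λ i → - f i) ≈ - sum f
  sum-neg {zero}  f = sym -0#≈0#
  sum-neg {suc n} f = trans (+-congˡ (sum-neg (f ∘ suc))) (-‿+-comm _ _)

  sum-- : ∀ {n} (f g : Vector Carrier n) → sum (λ i → f i - g i) ≈ sum f - sum g
  sum-- f g = trans (∑-distrib-+ f (λ i → - g i)) (+-congˡ (sum-neg g))

  ∣sum∣≤sum∣∣ : ∀ {n} (f : Vector Carrier n) → ∣ sum f ∣ ≤ sum (λ i → ∣ f i ∣)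
  ∣sum∣≤sum∣∣ {zero}  f = ≤-reflexive (0≤x⇒∣x∣≈x ≤-refl)
  ∣sum∣≤sum∣∣ {suc n} f =
    ≤-trans (∣x+y∣≤∣x∣+∣y∣ _ _) (+-mono-≤ ≤-refl (∣sum∣≤sum∣∣ (f ∘ suc)))

  -- Associativity of the product row vector, matrix, column vector, obtained by exchanging the two
  -- sums.
  sum-*-assoc : ∀ {m n} (f : Vector Carrier m) (A : Fin m → Fin n → Carrier) (g : Vector Carrier n) →
                sum (λ i → f i * sum (λ j → A i j * g j)) ≈
                sum (λ j → sum (λ i → f i * A i j) * g j)
  sum-*-assoc f A g = begin-equality
    sum (λ i → f i * sum (λ j → A i j * g j))
      ≈⟨ sum-cong-≋ (λ i → *-distribˡ-sum (f i) (λ j → A i j * g j)) ⟩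
    sum (λ i → sum (λ j → f i * (A i j * g j)))    ≈⟨ ∑-comm (λ i j → f i * (A i j * g j)) ⟩
    sum (λ j → sum (λ i → f i * (A i j * g j)))
      ≈⟨ sum-cong-≋ (λ j → sum-cong-≋ (λ i → *-assoc (f i) (A i j) (g j))) ⟨
    sum (λ j → sum (λ i → f i * A i j * g j))
      ≈⟨ sum-cong-≋ (λ j → *-distribʳ-sum (g j) (λ i → f i * A i j)) ⟨
    sum (λ j → sum (λ i → f i * A i j) * g j)      ∎

  -- The shift contributes `sum f * k`, which vanishes. It serves twice: for the router errors and
  -- for the deviations from `π`, both of total mass zero.
  sum-*-shift : ∀ {n} (f g : Vector Carrier n) k → sum f ≈ 0# →
                sum (λ i → f i * g i) ≈ sum (λ i → f i * (g i - k))
  sum-*-shift f g k sum≈0 = begin-equality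
    sum (λ i → f i * g i)                              ≈⟨ +-identityʳ _ ⟨
    sum (λ i → f i * g i) + 0#
      ≈⟨ +-congˡ (trans (-‿cong (trans (*-congʳ sum≈0) (zeroˡ k))) -0#≈0#) ⟨
    sum (λ i → f i * g i) - sum f * k                  ≈⟨ +-congˡ (-‿cong (*-distribʳ-sum k f)) ⟩
    sum (λ i → f i * g i) - sum (λ i → f i * k)        ≈⟨ sum-- (λ i → f i * g i) (λ i → f i * k) ⟨
    sum (λ i → f i * g i - f i * k)
      ≈⟨ sum-cong-≋ (λ i → *-distribˡ-- (f i) (g i) k) ⟨
    sum (λ i → f i * (g i - k))                        ∎

  partialSum : (ℕ → Carrier) → ℕ → Carrier
  partialSum f zero    = 0#
  partialSum f (suc n) = partialSum f n + f n

  partialSum-mono-≤ : ∀ {f g} → (∀ i → f i ≤ g i) → ∀ n → partialSum f n ≤ partialSum g n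
  partialSum-mono-≤ f≤g zero    = ≤-refl
  partialSum-mono-≤ f≤g (suc n) = +-mono-≤ (partialSum-mono-≤ f≤g n) (f≤g n)

  *-distribˡ-partialSum : ∀ x f n → x * partialSum f n ≈ partialSum (λ i → x * f i) n
  *-distribˡ-partialSum x f zero    = zeroʳ x
  *-distribˡ-partialSum x f (suc n) =
    trans (distribˡ x _ _) (+-congʳ (*-distribˡ-partialSum x f n))

  partialSum-const : ∀ x n → partialSum (λ _ → x) n ≈ x * fromℕ n
  partialSum-const x zero    = sym (zeroʳ x)
  partialSum-const x (suc n) = begin-equality
    partialSum (λ _ → x) n + x  ≈⟨ +-cong (partialSum-const x n) (sym (*-identityʳ x)) ⟩
    x * fromℕ n + x * 1#        ≈⟨ +-comm _ _ ⟩
    x * 1# + x * fromℕ n        ≈⟨ distribˡ x 1# (fromℕ n) ⟨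
    x * fromℕ (suc n)           ∎

  partialSum-split : ∀ f m n →
                     partialSum f (n ℕ.+ m) ≈ partialSum f m + partialSum (λ i → f (i ℕ.+ m)) n
  partialSum-split f m zero    = sym (+-identityʳ _)
  partialSum-split f m (suc n) = trans (+-congʳ (partialSum-split f m n)) (+-assoc _ _ _)

  partialSum-≤-+ : ∀ {f} → (∀ i → 0# ≤ f i) → ∀ m n → partialSum f n ≤ partialSum f (m ℕ.+ n)
  partialSum-≤-+ 0≤f zero    n = ≤-refl
  partialSum-≤-+ 0≤f (suc m) n =
    ≤-respˡ (+-identityʳ _) (+-mono-≤ (partialSum-≤-+ 0≤f m n) (0≤f (m ℕ.+ n)))

  fromℕ-sum : ∀ {n} (f : Vector ℕ n) → fromℕ (sumℕ f) ≈ sum (fromℕ ∘ f)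
  fromℕ-sum {zero}  f = refl
  fromℕ-sum {suc n} f = trans (fromℕ-+ (f zero) _) (+-congˡ (fromℕ-sum (f ∘ suc)))

  -- The weight is row `v` of the identity matrix `P ^ 0`; the companion `sum-δʳ` treats its column
  -- `v`.
  sum-δˡ : ∀ {n} v (f : Vector Carrier n) →
           sum (λ x → (if does (v ≟ᶠ x) then 1# else 0#) * f x) ≈ f v
  sum-δˡ {suc n} zero f = begin-equality
    1# * f zero + sum (λ x → 0# * f (suc x))
      ≈⟨ +-cong (*-identityˡ _) (sum-zero {n} (λ x → zeroˡ _)) ⟩
    f zero + 0#                               ≈⟨ +-identityʳ _ ⟩
    f zero                                    ∎
  sum-δˡ {suc n} (suc v) f = trans (+-cong (zeroˡ _) (sum-δˡ v (f ∘ suc))) (+-identityˡ _)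

  sum-δʳ : ∀ {n} v (f : Vector Carrier n) →
           sum (λ x → f x * (if does (x ≟ᶠ v) then 1# else 0#)) ≈ f v
  sum-δʳ {suc n} zero f = begin-equality
    f zero * 1# + sum (λ x → f (suc x) * 0#)
      ≈⟨ +-cong (*-identityʳ _) (sum-zero {n} (λ x → zeroʳ _)) ⟩
    f zero + 0#                               ≈⟨ +-identityʳ _ ⟩
    f zero                                    ∎
  sum-δʳ {suc n} (suc v) f = trans (+-cong (zeroʳ _) (sum-δʳ v (f ∘ suc))) (+-identityˡ _)

  ≤-indicator : ∀ {a} {A : Set a} (A? : Dec A) {x y} → (A → x ≤ y) → (¬ A → x ≤ 0#) →
                x ≤ (if does A? then y else 0#)
  ≤-indicator (yes p) x≤y x≤0 = x≤y p
  ≤-indicator (no ¬p) x≤y x≤0 = x≤0 ¬p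

  -- The enumeration `f` is general so that the induction can pass to `f ∘ suc`. Taking `f` to be
  -- `id` turns the count into a degree `δ`.
  sum-indicator : ∀ {a p} {A : Set a} {Q : Pred A p} (Q? : Decidable Q) x {n} (f : Fin n → A) →
                  sum (λ i → if does (Q? (f i)) then x else 0#) ≈
                  x * fromℕ (length (filter Q? (tabulate f)))
  sum-indicator Q? x {zero}  f = sym (zeroʳ x)
  sum-indicator Q? x {suc n} f with does (Q? (f zero))
  ... | true  = begin-equality
    x + _                   ≈⟨ +-cong (sym (*-identityʳ x)) (sum-indicator Q? x (f ∘ suc)) ⟩
    x * 1# + x * fromℕ k    ≈⟨ distribˡ x 1# (fromℕ k) ⟨
    x * fromℕ (suc k)       ∎
    where k = length (filter Q? (tabulate (f ∘ suc)))
  ... | false = trans (+-identityˡ _) (sum-indicator Q? x (f ∘ suc))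

  -- Each list element lies in exactly one fibre, so the head adds a Kronecker delta, whose sum is
  -- `1#`. Applied to a router, this says that no token is lost.
  sum-fibres : ∀ {a} {A : Set a} {n} (f : A → Fin n) (xs : List A) →
               sum (λ u → fromℕ (length (filter (λ x → f x ≟ᶠ u) xs))) ≈ fromℕ (length xs)
  sum-fibres {n = n} f [] = sum-zero {n} (λ _ → refl)
  sum-fibres {A = A} {n = n} f (x ∷ xs) = begin-equality
    sum (fromℕ ∘ fibre (x ∷ xs))                           ≈⟨ sum-cong-≋ split ⟩
    sum (λ u → δ[fx] u * 1# + fromℕ (fibre xs u))          ≈⟨ ∑-distrib-+ (λ u → δ[fx] u * 1#) _ ⟩
    sum (λ u → δ[fx] u * 1#) + sum (fromℕ ∘ fibre xs)
      ≈⟨ +-cong (sum-δˡ (f x) (λ _ → 1#)) (sum-fibres f xs) ⟩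
    1# + fromℕ (length xs)                                 ∎
    where
    fibre : List A → Fin n → ℕ
    fibre xs u = length (filter (λ x → f x ≟ᶠ u) xs)
    δ[fx] : Fin n → Carrier
    δ[fx] u = if does (f x ≟ᶠ u) then 1# else 0#
    split : ∀ u → fromℕ (fibre (x ∷ xs) u) ≈ δ[fx] u * 1# + fromℕ (fibre xs u)
    split u with does (f x ≟ᶠ u)
    ... | true  = +-congʳ (sym (*-identityʳ 1#))
    ... | false = sym (trans (+-congʳ (zeroˡ 1#)) (+-identityˡ _))

  -- Splitting off one period of length τ bounds the tail G by G ≤ q τ + q G.
  geometric-bound : ∀ (e : ℕ → Carrier) q τ → (∀ t → 0# ≤ e t) → (∀ t → e t ≤ 2#) → 0# < 1# - q →
                    (∀ t → e (t ℕ.+ τ) ≤ q) → (∀ t → e (t ℕ.+ τ) ≤ q * e t) →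
                    ∀ T → (1# - q) * partialSum e T ≤ (2# - q) * fromℕ τ
  geometric-bound e q τ 0≤e e≤2 (0≤1-q , _) e≤q e≤qe T = begin
    (1# - q) * partialSum e T                      ≤⟨ *-monoˡ-≤ 0≤1-q (split e 0≤e e≤2) ⟩
    (1# - q) * (2# * fromℕ τ + G)                  ≈⟨ distribˡ _ _ _ ⟩
    (1# - q) * (2# * fromℕ τ) + (1# - q) * G       ≤⟨ +-mono-≤ ≤-refl tail ⟩
    (1# - q) * (2# * fromℕ τ) + q * fromℕ τ
      -- Here `a` stands for `1# - q`, which makes this a semiring identity; the following line
      -- simplifies `(1# - q) + q`.
      ≈⟨ solve 3 (λ a q t → a :* (two :* t) :+ q :* t := (a :+ (a :+ q)) :* t) refl (1# - q) q (fromℕ τ) ⟩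
    ((1# - q) + ((1# - q) + q)) * fromℕ τ          ≈⟨ *-congʳ (+-congˡ ([x-y]+y≈x 1# q)) ⟩
    ((1# - q) + 1#) * fromℕ τ
      ≈⟨ *-congʳ (solve 1 (λ -q → (con 1 :+ -q) :+ con 1 := two :+ -q) refl (- q)) ⟩
    (2# - q) * fromℕ τ                             ∎
    where
    two : ∀ {n} → Polynomial n
    two = con 1 :+ (con 1 :+ con 0)
    G = partialSum (λ t → e (t ℕ.+ τ)) T
    split : ∀ f {b} → (∀ t → 0# ≤ f t) → (∀ t → f t ≤ b) →
            partialSum f T ≤ b * fromℕ τ + partialSum (λ t → f (t ℕ.+ τ)) T
    split f {b} 0≤f f≤b = begin
      -- Lengthening the sum to `τ ℕ.+ T` terms avoids a case distinction on whether `T` reaches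
      -- `τ`.
      partialSum f T            ≤⟨ partialSum-≤-+ 0≤f τ T ⟩
      partialSum f (τ ℕ.+ T)    ≡⟨ ≡.cong (partialSum f) (ℕ.+-comm τ T) ⟩
      partialSum f (T ℕ.+ τ)    ≈⟨ partialSum-split f τ T ⟩
      partialSum f τ + _        ≤⟨ +-monoˡ-≤ _ (partialSum-mono-≤ f≤b τ) ⟩
      partialSum (λ _ → b) τ + _  ≈⟨ +-congʳ (partialSum-const b τ) ⟩
      b * fromℕ τ + _           ∎
    tail : (1# - q) * G ≤ q * fromℕ τ
    tail = begin
      (1# - q) * G     ≈⟨ *-distribʳ-- G 1# q ⟩
      1# * G - q * G   ≈⟨ +-congʳ (*-identityˡ G) ⟩
      G - q * G        ≤⟨ x≤y+z⇒x-y≤z (begin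
        G
          -- A second period is split off, now with the termwise bound `q` instead of `2#`; the new
          -- tail is at most `q * G`.
          ≤⟨ split (λ t → e (t ℕ.+ τ)) (λ t → 0≤e (t ℕ.+ τ)) e≤q ⟩
        q * fromℕ τ + partialSum (λ t → e (t ℕ.+ τ ℕ.+ τ)) T
          ≤⟨ +-mono-≤ ≤-refl (partialSum-mono-≤ (λ t → e≤qe (t ℕ.+ τ)) T) ⟩
        q * fromℕ τ + partialSum (λ t → q * e (t ℕ.+ τ)) T
          ≈⟨ +-congˡ (*-distribˡ-partialSum q _ T) ⟨
        q * fromℕ τ + q * G                                      ≈⟨ +-comm _ _ ⟩
        q * G + q * fromℕ τ                                      ∎) ⟩
      q * fromℕ τ      ∎

-- Powers of a stochastic matrix and the ℓ¹ norm.

module Chain {c ℓ₁ ℓ₂} (ℝ : CompleteOrderedField c ℓ₁ ℓ₂) where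
  open CompleteOrderedField ℝ
  open MarkovChain ℝ
  open OrderedField ℝ
  open Sums ℝ

  ^-+ : ∀ {N} (P : Matrix N) s t v u →
        (P ^ (s ℕ.+ t)) v u ≈ sum (λ x → (P ^ s) v x * (P ^ t) x u)
  ^-+ P zero    t v u = sym (sum-δˡ v (λ x → (P ^ t) x u))
  ^-+ {N} P (suc s) t v u = begin-equality
    sum (λ x → P v x * (P ^ (s ℕ.+ t)) x u)
      ≈⟨ sum-cong-≋ {N} (λ x → *-congˡ (^-+ P s t x u)) ⟩
    sum (λ x → P v x * sum (λ y → (P ^ s) x y * (P ^ t) y u))
      ≈⟨ sum-*-assoc (P v) (P ^ s) (λ y → (P ^ t) y u) ⟩
    sum (λ y → (P ^ suc s) v y * (P ^ t) y u)                  ∎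

  ^-1 : ∀ {N} (P : Matrix N) v u → (P ^ 1) v u ≈ P v u
  ^-1 P v u = sum-δʳ u (P v)

  -- Powers are defined by multiplying by `P` on the left; detailed balance reverses paths and
  -- therefore needs the factor on the right.
  ^-sucʳ : ∀ {N} (P : Matrix N) t v u → (P ^ suc t) v u ≈ sum (λ x → (P ^ t) v x * P x u)
  ^-sucʳ {N} P t v u = begin-equality
    (P ^ suc t) v u                          ≡⟨ ≡.cong (λ k → (P ^ k) v u) (ℕ.+-comm 1 t) ⟩
    (P ^ (t ℕ.+ 1)) v u                      ≈⟨ ^-+ P t 1 v u ⟩
    sum (λ x → (P ^ t) v x * (P ^ 1) x u)    ≈⟨ sum-cong-≋ {N} (λ x → *-congˡ (^-1 P x u)) ⟩
    sum (λ x → (P ^ t) v x * P x u)          ∎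

  ^-isStochastic : ∀ {N} {P : Matrix N} → IsStochastic P → ∀ t → IsStochastic (P ^ t)
  ^-isStochastic {N} {P} stoch zero v = nonNeg , total-mass
    where
    nonNeg : ∀ u → 0# ≤ (P ^ 0) v u
    nonNeg u with does (v ≟ᶠ u)
    ... | true  = 0≤1
    ... | false = ≤-refl
    total-mass : sum ((P ^ 0) v) ≈ 1#
    total-mass = trans (sum-cong-≋ {N} (λ u → sym (*-identityʳ _))) (sum-δˡ v (λ _ → 1#))
  ^-isStochastic {N} {P} stoch (suc t) v =
    (λ u → sum-nonNegative {N} (λ x → *-nonNegative (proj₁ (stoch v) x) (proj₁ (IH x) u))) ,
    (begin-equality
      sum (λ u → sum (λ x → P v x * (P ^ t) x u))  ≈⟨ ∑-comm (λ u x → P v x * (P ^ t) x u) ⟩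
      sum (λ x → sum (λ u → P v x * (P ^ t) x u))
        ≈⟨ sum-cong-≋ {N} (λ x → *-distribˡ-sum (P v x) ((P ^ t) x)) ⟨
      sum (λ x → P v x * sum ((P ^ t) x))
        ≈⟨ sum-cong-≋ {N} (λ x → trans (*-congˡ (proj₂ (IH x))) (*-identityʳ _)) ⟩
      sum (P v)                                    ≈⟨ proj₂ (stoch v) ⟩
      1#                                           ∎)
    where IH = ^-isStochastic stoch t

  ^-stationary : ∀ {N} {P : Matrix N} {π} → IsStationary P π → ∀ t u → (π *ᴹ (P ^ t)) u ≈ π u
  ^-stationary     {π = π} stat zero    u = sum-δʳ u π
  ^-stationary {N} {P} {π} stat (suc t) u = begin-equality
    sum (λ v → π v * sum (λ x → P v x * (P ^ t) x u))  ≈⟨ sum-*-assoc π P (λ x → (P ^ t) x u) ⟩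
    sum (λ x → (π *ᴹ P) x * (P ^ t) x u)
      ≈⟨ sum-cong-≋ {N} (λ x → *-congʳ (proj₂ stat x)) ⟩
    (π *ᴹ (P ^ t)) u                                   ≈⟨ ^-stationary stat t u ⟩
    π u                                                ∎

  -- Detailed balance carries the weight across the first step `P u x` and, by induction, across the
  -- remaining `t` steps, reversing the path from `u` to `v`.
  ^-isReversible : ∀ {N} {P : Matrix N} {π} → IsReversible P π → ∀ t → IsReversible (P ^ t) π
  ^-isReversible {N} {P} {π} rev zero u v with u ≟ᶠ v | v ≟ᶠ u
  ... | yes ≡.refl | yes _   = refl
  ... | yes u≡v    | no  v≢u = contradiction (≡.sym u≡v) v≢u
  ... | no  u≢v    | yes v≡u = contradiction (≡.sym v≡u) u≢v
  ... | no  _      | no  _   = trans (zeroʳ _) (sym (zeroʳ _))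
  ^-isReversible {N} {P} {π} rev (suc t) u v = begin-equality
    π u * sum (λ x → P u x * (P ^ t) x v)  ≈⟨ *-distribˡ-sum (π u) (λ x → P u x * (P ^ t) x v) ⟩
    sum (λ x → π u * (P u x * (P ^ t) x v))  ≈⟨ sum-cong-≋ {N} (λ x → begin-equality
      π u * (P u x * (P ^ t) x v)    ≈⟨ *-assoc _ _ _ ⟨
      π u * P u x * (P ^ t) x v      ≈⟨ *-congʳ (rev u x) ⟩
      π x * P x u * (P ^ t) x v
        ≈⟨ solve 3 (λ a b c → a :* b :* c := a :* c :* b) refl (π x) (P x u) ((P ^ t) x v) ⟩
      π x * (P ^ t) x v * P x u      ≈⟨ *-congʳ (^-isReversible rev t x v) ⟩
      π v * (P ^ t) v x * P x u      ≈⟨ *-assoc _ _ _ ⟩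
      π v * ((P ^ t) v x * P x u)    ∎) ⟩
    sum (λ x → π v * ((P ^ t) v x * P x u))  ≈⟨ *-distribˡ-sum (π v) (λ x → (P ^ t) v x * P x u) ⟨
    π v * sum (λ x → (P ^ t) v x * P x u)    ≈⟨ *-congˡ (^-sucʳ P t v u) ⟨
    π v * (P ^ suc t) v u                    ∎

  ‖_‖₁ : ∀ {N} → Vector Carrier N → Carrier
  ‖ ξ ‖₁ = sum (λ v → ∣ ξ v ∣)

  -- After the triangle inequality and an exchange of sums, each `∣ ξ v ∣` is weighted by the norm
  -- of row `v`. This is used for stochastic rows, with `k` equal to `1#`, and for rows of
  -- deviations, where `k` becomes the contraction factor.
  ‖*ᴹ‖₁≤ : ∀ {N} (ξ : Vector Carrier N) (R : Matrix N) {k} → (∀ v → ‖ R v ‖₁ ≤ k) →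
           ‖ ξ *ᴹ R ‖₁ ≤ k * ‖ ξ ‖₁
  ‖*ᴹ‖₁≤ {N} ξ R {k} ‖R‖≤k = begin
    sum (λ u → ∣ sum (λ v → ξ v * R v u) ∣)
      ≤⟨ sum-mono-≤ {N} (λ u → ∣sum∣≤sum∣∣ (λ v → ξ v * R v u)) ⟩
    sum (λ u → sum (λ v → ∣ ξ v * R v u ∣))      ≈⟨ ∑-comm (λ u v → ∣ ξ v * R v u ∣) ⟩
    sum (λ v → sum (λ u → ∣ ξ v * R v u ∣))
      ≈⟨ sum-cong-≋ {N} (λ v → sum-cong-≋ {N} (λ u → ∣x*y∣≈∣x∣*∣y∣ (ξ v) (R v u))) ⟩
    sum (λ v → sum (λ u → ∣ ξ v ∣ * ∣ R v u ∣))
      ≈⟨ sum-cong-≋ {N} (λ v → *-distribˡ-sum ∣ ξ v ∣ (λ u → ∣ R v u ∣)) ⟨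
    sum (λ v → ∣ ξ v ∣ * ‖ R v ‖₁)
      ≤⟨ sum-mono-≤ {N} (λ v → *-monoˡ-≤ (∣∣-nonNegative (ξ v)) (‖R‖≤k v)) ⟩
    sum (λ v → ∣ ξ v ∣ * k)                      ≈⟨ *-distribʳ-sum k (λ v → ∣ ξ v ∣) ⟨
    ‖ ξ ‖₁ * k                                   ≈⟨ *-comm _ _ ⟩
    k * ‖ ξ ‖₁                                   ∎

  distribution-‖‖₁ : ∀ {N} {ξ : Vector Carrier N} → IsDistribution ξ → ‖ ξ ‖₁ ≈ 1#
  distribution-‖‖₁ {N} (0≤ξ , sum≈1) = trans (sum-cong-≋ {N} (λ v → 0≤x⇒∣x∣≈x (0≤ξ v))) sum≈1

  -- Duhamel's principle: the deviation of a perturbed chain from the linear one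
  -- is the sum of the propagated one-step errors.
  perturbation-bound : ∀ {N} (P : Matrix N) (w : Fin N) (b : ℕ → Carrier) (x : ℕ → Vector Carrier N) →
    (∀ t s → ∣ sum (λ u → (x (suc t) u - (x t *ᴹ P) u) * (P ^ s) u w) ∣ ≤ b s) →
    ∀ T → ∣ x T w - (x 0 *ᴹ (P ^ T)) w ∣ ≤ partialSum b T
  perturbation-bound P w b x err≤b zero = ≤-reflexive (trans (∣∣-cong (begin-equality
    x 0 w - (x 0 *ᴹ (P ^ 0)) w  ≈⟨ +-congˡ (-‿cong (sum-δʳ w (x 0))) ⟩
    x 0 w - x 0 w               ≈⟨ -‿inverseʳ _ ⟩
    0#                          ∎)) (0≤x⇒∣x∣≈x ≤-refl))
  perturbation-bound {N} P w b x err≤b (suc T) = begin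
    ∣ x (suc T) w - z ∣                ≈⟨ ∣∣-cong (telescope (x (suc T) w) y z) ⟨
    ∣ (x (suc T) w - y) + (y - z) ∣    ≤⟨ ∣x+y∣≤∣x∣+∣y∣ _ _ ⟩
    ∣ x (suc T) w - y ∣ + ∣ y - z ∣
      -- The first step is peeled off: the trajectory `x ∘ suc` satisfies the same hypothesis, and
      -- `y - z` is the error at time 0 propagated for `T` further steps.
      ≤⟨ +-mono-≤ (perturbation-bound P w b (x ∘ suc) (err≤b ∘ suc) T)
                                                   (≤-respˡ (∣∣-cong (sym y-z≈)) (err≤b 0 T)) ⟩
    partialSum b T + b T               ∎
    where
    y = (x 1 *ᴹ (P ^ T)) w
    z = (x 0 *ᴹ (P ^ suc T)) w
    f : Fin N → Carrier
    f u = (P ^ T) u w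
    y-z≈ : y - z ≈ sum (λ u → (x 1 u - (x 0 *ᴹ P) u) * f u)
    y-z≈ = begin-equality
      y - z
        ≈⟨ +-congˡ (-‿cong (sum-*-assoc (x 0) P f)) ⟩
      y - sum (λ u → (x 0 *ᴹ P) u * f u)
        ≈⟨ sum-- (λ u → x 1 u * f u) (λ u → (x 0 *ᴹ P) u * f u) ⟨
      sum (λ u → x 1 u * f u - (x 0 *ᴹ P) u * f u)
        ≈⟨ sum-cong-≋ {N} (λ u → *-distribʳ-- (f u) (x 1 u) ((x 0 *ᴹ P) u)) ⟨
      sum (λ u → (x 1 u - (x 0 *ᴹ P) u) * f u)               ∎

  -- Deviation from stationarity and its decay.

  module Stationary {N} {P : Matrix N} {π : Vector Carrier N}
                    (stoch : IsStochastic P) (stat : IsStationary P π) where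

    -- Its ℓ¹ norm is twice the total variation distance of row `w` from `π`.
    deviation : Fin N → ℕ → Vector Carrier N
    deviation w t u = (P ^ t) w u - π u

    sum-deviation : ∀ w t → sum (deviation w t) ≈ 0#
    sum-deviation w t = begin-equality
      sum (deviation w t)        ≈⟨ sum-- ((P ^ t) w) π ⟩
      sum ((P ^ t) w) - sum π
        ≈⟨ +-cong (proj₂ (^-isStochastic stoch t w)) (-‿cong (proj₂ (proj₁ stat))) ⟩
      1# - 1#                    ≈⟨ -‿inverseʳ 1# ⟩
      0#                         ∎

    -- Stationarity writes `π` as `π *ᴹ (P ^ t)`, so both terms of the difference are advanced by
    -- the same matrix.
    deviation-+ : ∀ w s t u → deviation w (s ℕ.+ t) u ≈ (deviation w s *ᴹ (P ^ t)) u
    deviation-+ w s t u = begin-equality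
      (P ^ (s ℕ.+ t)) w u - π u
        ≈⟨ +-cong (^-+ P s t w u) (-‿cong (sym (^-stationary stat t u))) ⟩
      sum (λ x → (P ^ s) w x * Pᵗ x) - sum (λ x → π x * Pᵗ x)
        ≈⟨ sum-- (λ x → (P ^ s) w x * Pᵗ x) (λ x → π x * Pᵗ x) ⟨
      sum (λ x → (P ^ s) w x * Pᵗ x - π x * Pᵗ x)
        ≈⟨ sum-cong-≋ {N} (λ x → *-distribʳ-- (Pᵗ x) ((P ^ s) w x) (π x)) ⟨
      sum (λ x → deviation w s x * Pᵗ x)                             ∎
      where
      Pᵗ : Fin N → Carrier
      Pᵗ x = (P ^ t) x u

    -- A deviation has total mass zero, so `π u` may be subtracted from column `u` of `P ^ t`; its
    -- rows thereby become deviations themselves. With `t` equal to `τ` the norm contracts over each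
    -- period.
    ‖deviation‖-+≤ : ∀ w s t {k} → (∀ v → ‖ deviation v t ‖₁ ≤ k) →
                     ‖ deviation w (s ℕ.+ t) ‖₁ ≤ k * ‖ deviation w s ‖₁
    ‖deviation‖-+≤ w s t {k} dev≤k = begin
      ‖ deviation w (s ℕ.+ t) ‖₁
        ≈⟨ sum-cong-≋ {N} (λ u → ∣∣-cong (trans (deviation-+ w s t u)
            (sum-*-shift (deviation w s) (λ x → (P ^ t) x u) (π u) (sum-deviation w s)))) ⟩
      ‖ deviation w s *ᴹ (λ x → deviation x t) ‖₁
        ≤⟨ ‖*ᴹ‖₁≤ (deviation w s) (λ x → deviation x t) dev≤k ⟩
      k * ‖ deviation w s ‖₁                        ∎

    -- Advancing by a stochastic matrix cannot increase the ℓ¹ norm. This carries a bound reached at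
    -- one time to all later times.
    ‖deviation‖-antitone : ∀ w {s t} → s ℕ.≤ t → ‖ deviation w t ‖₁ ≤ ‖ deviation w s ‖₁
    ‖deviation‖-antitone w {s} {t} s≤t = begin
      ‖ deviation w t ‖₁                       ≡⟨ ≡.cong (λ k → ‖ deviation w k ‖₁) (ℕ.m+[n∸m]≡n s≤t) ⟨
      ‖ deviation w (s ℕ.+ r) ‖₁
        ≈⟨ sum-cong-≋ {N} (λ u → ∣∣-cong (deviation-+ w s r u)) ⟩
      ‖ deviation w s *ᴹ (P ^ r) ‖₁
        ≤⟨ ‖*ᴹ‖₁≤ (deviation w s) (P ^ r) (λ v → ≤-reflexive (distribution-‖‖₁ (^-isStochastic stoch r v))) ⟩
      1# * ‖ deviation w s ‖₁                  ≈⟨ *-identityˡ _ ⟩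
      ‖ deviation w s ‖₁                       ∎
      where r = t ℕ.∸ s

    ‖deviation‖≤2 : ∀ w t → ‖ deviation w t ‖₁ ≤ 2#
    ‖deviation‖≤2 w t = begin
      ‖ deviation w t ‖₁
        ≤⟨ sum-mono-≤ {N} (λ u → ∣x+y∣≤∣x∣+∣y∣ ((P ^ t) w u) (- π u)) ⟩
      sum (λ u → ∣ (P ^ t) w u ∣ + ∣ - π u ∣)
        ≈⟨ ∑-distrib-+ (λ u → ∣ (P ^ t) w u ∣) (λ u → ∣ - π u ∣) ⟩
      ‖ (P ^ t) w ‖₁ + sum (λ u → ∣ - π u ∣)
        ≈⟨ +-congˡ (sum-cong-≋ {N} (λ u → ∣-x∣≈∣x∣ (π u))) ⟩
      ‖ (P ^ t) w ‖₁ + ‖ π ‖₁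
        ≈⟨ +-cong (distribution-‖‖₁ (^-isStochastic stoch t w)) (distribution-‖‖₁ (proj₁ stat)) ⟩
      1# + 1#                                       ≈⟨ +-congˡ (+-identityʳ 1#) ⟨
      2#                                            ∎

    dTV≤⇒‖deviation‖≤ : ∀ w t {γ} → dTV ((P ^ t) w) π ≤ γ → ‖ deviation w t ‖₁ ≤ 2# * γ
    dTV≤⇒‖deviation‖≤ w t {γ} dTV≤γ = begin
      d                       ≈⟨ *-identityˡ d ⟨
      1# * d                  ≈⟨ *-congʳ (*-inverseʳ 2# (0<x⇒x≉0 0<2)) ⟨
      2# / 2# * d             ≈⟨ *-assoc _ _ _ ⟩
      2# * (2# ⁻¹ * d)        ≈⟨ *-congˡ (*-congʳ (*-identityˡ _)) ⟨
      2# * (1# / 2# * d)      ≤⟨ *-monoˡ-≤ (proj₁ 0<2) dTV≤γ ⟩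
      2# * γ                  ∎
      where d = ‖ deviation w t ‖₁

    partialSum-‖deviation‖≤ : ∀ {γ τ} → γ < 1# / 2# → IsMixingTime P π γ τ → ∀ w T →
      partialSum (λ t → ‖ deviation w t ‖₁) T ≤ (2# * (1# - γ)) / (1# - 2# * γ) * fromℕ τ
    partialSum-‖deviation‖≤ {γ} {τ} γ<1/2 (m , m-least , ≡.refl) w T = begin
      D
        ≤⟨ x*y≤z⇒x≤z/y 0<1-2γ (≤-respˡ (*-comm _ _) bound) ⟩
      (2# - 2# * γ) * fromℕ τ / (1# - 2# * γ)
        ≈⟨ solve 3 (λ a b c → a :* b :* c := a :* c :* b) refl _ _ _ ⟩
      (2# - 2# * γ) / (1# - 2# * γ) * fromℕ τ
        ≈⟨ *-congʳ (*-congʳ (trans (*-distribˡ-- 2# 1# γ) (+-congʳ (*-identityʳ 2#)))) ⟨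
      (2# * (1# - γ)) / (1# - 2# * γ) * fromℕ τ            ∎
      where
      D = partialSum (λ t → ‖ deviation w t ‖₁) T
      0<1-2γ : 0# < 1# - 2# * γ
      0<1-2γ = x<1/y⇒0<1-y*x 0<2 γ<1/2
      at-τ : ∀ v → ‖ deviation v τ ‖₁ ≤ 2# * γ
      -- Row `v` is close to `π` at its own time `m v`; since `τ` is the maximum of these times,
      -- monotonicity extends the bound to `τ`.
      at-τ v = ≤-trans (‖deviation‖-antitone v (tabulate⁻ (ExtremaNat.xs≤max 0 (tabulate m)) v))
                       (dTV≤⇒‖deviation‖≤ v (m v) (proj₁ (m-least v)))
      bound : (1# - 2# * γ) * D ≤ (2# - 2# * γ) * fromℕ τ
      -- The ratio is `2# * γ` because the ℓ¹ distance doubles the total variation distance;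
      -- `2# - 2# * γ` is then the numerator of the claimed constant.
      bound = geometric-bound (λ t → ‖ deviation w t ‖₁) (2# * γ) τ
        (λ t → sum-nonNegative {N} (λ u → ∣∣-nonNegative (deviation w t u)))
        (‖deviation‖≤2 w)
        0<1-2γ
        (λ t → ≤-trans (‖deviation‖-antitone w (ℕ.m≤n+m τ t)) (at-τ w))
        (λ t → ‖deviation‖-+≤ w t τ at-τ)
        T

-- Consequences of detailed balance.

module Reversible {c ℓ₁ ℓ₂} (ℝ : CompleteOrderedField c ℓ₁ ℓ₂) where
  open CompleteOrderedField ℝ
  open MarkovChain ℝ
  open OrderedField ℝ
  open Sums ℝ
  open Chain ℝ

  -- If `π u` vanished, detailed balance for a power with positive entry from `v` to `u` would force
  -- `π v` to vanish for every `v`, contradicting total mass one.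
  stationary-positive : ∀ {N} {P : Matrix N} {π} → IsIrreducible P → IsStationary P π →
                        IsReversible P π → ∀ u → 0# < π u
  stationary-positive {N} {P} {π} irr ((0≤π , sum≈1) , _) rev u =
    0≤x∧x≉0⇒0<x (0≤π u) λ πu≈0 → 0≉1 (trans (sym (sum-zero {N} (π≈0 πu≈0))) sum≈1)
    where
    π≈0 : π u ≈ 0# → ∀ v → π v ≈ 0#
    π≈0 πu≈0 v with irr v u
    ... | t , 0<Pᵗvu = x*y≈0∧y≉0⇒x≈0
      (trans (^-isReversible rev t v u) (trans (*-congʳ πu≈0) (zeroˡ _))) (0<x⇒x≉0 0<Pᵗvu)

  minimum≤ : ∀ {n} (π : Vector Carrier (suc n)) u → minimum π ≤ π u
  minimum≤ π = tabulate⁻ (Extrema.min≤xs totalOrder (π zero) (tabulate π))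

  minimum-positive : ∀ {n} (π : Vector Carrier (suc n)) → (∀ u → 0# < π u) → 0# < minimum π
  minimum-positive π 0<π = Extrema.v<min⁺ totalOrder (0<π zero) (tabulate⁺ 0<π)

  module _ {n} {P : Matrix (suc n)} {π : Vector Carrier (suc n)} (stoch : IsStochastic P)
           (irr : IsIrreducible P) (stat : IsStationary P π) (rev : IsReversible P π) where
    open Stationary stoch stat

    private
      0<π : ∀ u → 0# < π u
      0<π = stationary-positive irr stat rev

    -- Were `P v u` zero, detailed balance would give `π u * P u v ≈ 0#` with both factors positive.
    -- Hence the vertices routing into `u` can be counted by the out-degree of `u`.
    edge-sym : ∀ {u v} → 0# < P u v → 0# < P v u
    edge-sym {u} {v} 0<Puv = 0≤x∧x≉0⇒0<x (proj₁ (stoch v) u) λ Pvu≈0 →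
      0<x⇒x≉0 (0<π u) (x*y≈0∧y≉0⇒x≈0
        (trans (rev u v) (trans (*-congˡ Pvu≈0) (zeroʳ _))) (0<x⇒x≉0 0<Puv))

    -- Multiplying by `π u` lets detailed balance exchange column `w` for row `w`. Bounding `π u`
    -- below by `minimum π` makes the resulting factor independent of `u`, ready for summation.
    column-deviation : ∀ t u w → ∣ (P ^ t) u w - π w ∣ ≤ π w / minimum π * ∣ deviation w t u ∣
    column-deviation t u w = begin
      ∣ (P ^ t) u w - π w ∣                       ≤⟨ x*y≤z⇒x≤z/y (minimum-positive π 0<π) (begin
        ∣ (P ^ t) u w - π w ∣ * minimum π
          ≤⟨ *-monoˡ-≤ (∣∣-nonNegative _) (minimum≤ π u) ⟩
        ∣ (P ^ t) u w - π w ∣ * π u                   ≈⟨ *-comm _ _ ⟩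
        π u * ∣ (P ^ t) u w - π w ∣                   ≈⟨ 0≤x⇒∣x*y∣≈x*∣y∣ _ (proj₁ (0<π u)) ⟨
        ∣ π u * ((P ^ t) u w - π w) ∣                 ≈⟨ ∣∣-cong (begin-equality
          π u * ((P ^ t) u w - π w)                       ≈⟨ *-distribˡ-- _ _ _ ⟩
          π u * (P ^ t) u w - π u * π w
            ≈⟨ +-cong (^-isReversible rev t u w) (-‿cong (*-comm _ _)) ⟩
          π w * (P ^ t) w u - π w * π u                   ≈⟨ *-distribˡ-- _ _ _ ⟨
          π w * deviation w t u                           ∎) ⟩
        ∣ π w * deviation w t u ∣                     ≈⟨ 0≤x⇒∣x*y∣≈x*∣y∣ _ (proj₁ (0<π w)) ⟩
        π w * ∣ deviation w t u ∣                     ∎) ⟩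
      π w * ∣ deviation w t u ∣ / minimum π
        ≈⟨ solve 3 (λ a b c → a :* b :* c := a :* c :* b) refl _ _ _ ⟩
      π w / minimum π * ∣ deviation w t u ∣       ∎

-- One-step errors of the functional-router model.

module Router {c ℓ₁ ℓ₂} (ℝ : CompleteOrderedField c ℓ₁ ℓ₂) where
  open CompleteOrderedField ℝ
  open MarkovChain ℝ
  open FunctionalRouter ℝ
  open OrderedField ℝ
  open Sums ℝ
  open Chain ℝ
  open Reversible ℝ

  module _ {N} {P : Matrix N} (σ : Routers P) (χ₀ : Vector ℕ N) where

    -- Exactly the list of router indices that `I` filters inside `Z`, so `Z` is by definition a
    -- fibre count over it.
    served-at : ℕ → Fin N → List ℕ
    served-at t v =
      applyUpTo (served σ χ₀ t v ℕ.+_) (served σ χ₀ t v ℕ.+ χ σ χ₀ t v ℕ.∸ served σ χ₀ t v)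

    Z-off-edge : ∀ t v u → ¬ 0# < P v u → Z σ χ₀ t v u ≡ 0
    Z-off-edge t v u ¬edge = ≡.cong length
      (filter-none (λ j → proj₁ (σ v j) ≟ᶠ u) (All.universal unrouted (served-at t v)))
      where
      unrouted : ∀ j → ¬ proj₁ (σ v j) ≡ u
      unrouted j ≡.refl = ¬edge (proj₂ (σ v j))

    sum-Z : ∀ t v → sum (λ u → fromℕ (Z σ χ₀ t v u)) ≈ fromℕ (χ σ χ₀ t v)
    sum-Z t v = begin-equality
      sum (λ u → fromℕ (Z σ χ₀ t v u))
        ≈⟨ sum-fibres (proj₁ ∘ σ v) (served-at t v) ⟩
      fromℕ (length (served-at t v))
        ≡⟨ ≡.cong fromℕ (length-applyUpTo (s ℕ.+_) (s ℕ.+ χ σ χ₀ t v ℕ.∸ s)) ⟩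
      fromℕ (s ℕ.+ χ σ χ₀ t v ℕ.∸ s)
        ≡⟨ ≡.cong fromℕ (ℕ.m+n∸m≡n s (χ σ χ₀ t v)) ⟩
      fromℕ (χ σ χ₀ t v)  ∎
      where
      s : ℕ
      s = served σ χ₀ t v

    -- Defined for all pairs of vertices, although `Ψ` controls only edges, so that sums can run
    -- over the whole vertex set.
    discrepancy : ℕ → Fin N → Fin N → Carrier
    discrepancy t v u = fromℕ (Z σ χ₀ t v u) - fromℕ (χ σ χ₀ t v) * P v u

    -- Tokens actually sent and tokens expected both add up to the number of tokens at `v`.
    sum-discrepancy : IsStochastic P → ∀ t v → sum (discrepancy t v) ≈ 0#
    sum-discrepancy stoch t v = begin-equality
      sum (discrepancy t v)
        ≈⟨ sum-- (λ u → fromℕ (Z σ χ₀ t v u)) (λ u → k * P v u) ⟩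
      sum (λ u → fromℕ (Z σ χ₀ t v u)) - sum (λ u → k * P v u)
        ≈⟨ +-cong (sum-Z t v) (-‿cong (sym (*-distribˡ-sum k (P v)))) ⟩
      k - k * sum (P v)
        ≈⟨ +-congˡ (-‿cong (trans (*-congˡ (proj₂ (stoch v))) (*-identityʳ k))) ⟩
      k - k                                                  ≈⟨ -‿inverseʳ k ⟩
      0#                                                     ∎
      where k = fromℕ (χ σ χ₀ t v)

    discrepancy-off-edge : IsStochastic P → ∀ t v u → ¬ 0# < P v u → discrepancy t v u ≈ 0#
    discrepancy-off-edge stoch t v u ¬edge = begin-equality
      fromℕ (Z σ χ₀ t v u) - k * P v u  ≡⟨ ≡.cong (λ z → fromℕ z - k * P v u) (Z-off-edge t v u ¬edge) ⟩
      0# - k * P v u                    ≈⟨ +-congˡ (-‿cong (trans (*-congˡ Pvu≈0) (zeroʳ k))) ⟩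
      0# - 0#                           ≈⟨ -‿inverseʳ 0# ⟩
      0#                                ∎
      where
      k = fromℕ (χ σ χ₀ t v)
      Pvu≈0 : P v u ≈ 0#
      -- A nonnegative entry that is not positive is zero, by decidability of equality.
      Pvu≈0 with P v u ≟ 0#
      ... | yes p = p
      ... | no  q = contradiction (0≤x∧x≉0⇒0<x (proj₁ (stoch v) u) q) ¬edge

    stepError : ℕ → Vector Carrier N
    stepError t u = fromℕ (χ σ χ₀ (suc t) u) - ((fromℕ ∘ χ σ χ₀ t) *ᴹ P) u

    stepError≈ : ∀ t u → stepError t u ≈ sum (λ v → discrepancy t v u)
    stepError≈ t u = begin-equality
      stepError t u
        ≈⟨ +-congʳ (fromℕ-sum (λ v → Z σ χ₀ t v u)) ⟩
      sum (λ v → fromℕ (Z σ χ₀ t v u)) - sum (λ v → fromℕ (χ σ χ₀ t v) * P v u)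
        ≈⟨ sum-- (λ v → fromℕ (Z σ χ₀ t v u)) (λ v → fromℕ (χ σ χ₀ t v) * P v u) ⟨
      sum (λ v → discrepancy t v u)                                                ∎

    sum-stepError : IsStochastic P → ∀ t → sum (stepError t) ≈ 0#
    sum-stepError stoch t = begin-equality
      sum (stepError t)                            ≈⟨ sum-cong-≋ {N} (stepError≈ t) ⟩
      sum (λ u → sum (λ v → discrepancy t v u))    ≈⟨ ∑-comm (λ u v → discrepancy t v u) ⟩
      sum (λ v → sum (discrepancy t v))            ≈⟨ sum-zero {N} (sum-discrepancy stoch t) ⟩
      0#                                           ∎

    Ψ-bound : ∀ {Ψ} → IsΨ σ χ₀ Ψ → ∀ t v u → 0# < P v u → ∣ discrepancy t v u ∣ ≤ Ψ
    Ψ-bound (upper , _) t v u edge = upper _ (v , (u , edge) , t , refl)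

    -- The edge chosen by `σ v 0` supplies a discrepancy, whose absolute value lies between `0#` and
    -- `Ψ`.
    Ψ-nonNegative : ∀ {Ψ} → IsΨ σ χ₀ Ψ → Fin N → 0# ≤ Ψ
    Ψ-nonNegative isΨ v = ≤-trans (∣∣-nonNegative _) (Ψ-bound isΨ 0 v (proj₁ (σ v 0)) (proj₂ (σ v 0)))

    ∣stepError∣≤ : IsStochastic P → (∀ {u v} → 0# < P u v → 0# < P v u) → ∀ {Ψ} → IsΨ σ χ₀ Ψ →
                   ∀ t u → ∣ stepError t u ∣ ≤ Ψ * fromℕ (Δ P)
    ∣stepError∣≤ stoch edge-sym {Ψ} isΨ t u = begin
      ∣ stepError t u ∣                                       ≈⟨ ∣∣-cong (stepError≈ t u) ⟩
      ∣ sum (λ v → discrepancy t v u) ∣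
        ≤⟨ ∣sum∣≤sum∣∣ (λ v → discrepancy t v u) ⟩
      sum (λ v → ∣ discrepancy t v u ∣)                       ≤⟨ sum-mono-≤ {N} on-edges ⟩
      -- The test is on `P u v` instead of `P v u`, so that the count is the out-degree `δ P u`;
      -- `edge-sym` justifies the reversal.
      sum (λ v → if does (0# <? P u v) then Ψ else 0#)
        ≈⟨ sum-indicator (λ v → 0# <? P u v) Ψ id ⟩
      Ψ * fromℕ (δ P u)
        ≤⟨ *-monoˡ-≤ (Ψ-nonNegative isΨ u) (fromℕ-mono-≤ δ≤Δ) ⟩
      Ψ * fromℕ (Δ P)                                         ∎
      where
      δ≤Δ : δ P u ℕ.≤ Δ P
      δ≤Δ = tabulate⁻ (ExtremaNat.xs≤max 0 (tabulate (δ P))) u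
      on-edges : ∀ v → ∣ discrepancy t v u ∣ ≤ (if does (0# <? P u v) then Ψ else 0#)
      on-edges v = ≤-indicator (0# <? P u v)
        (λ 0<Puv → Ψ-bound isΨ t v u (edge-sym 0<Puv))
        (λ ¬edge → ≤-reflexive (trans
          (∣∣-cong (discrepancy-off-edge stoch t v u (¬edge ∘ edge-sym))) (0≤x⇒∣x∣≈x ≤-refl)))

-- Combination of the router errors with the mixing estimate.

theorem3p1 :
    ∀ {c ℓ₁ ℓ₂} (ℝ : CompleteOrderedField c ℓ₁ ℓ₂) →
    let open CompleteOrderedField ℝ
        open MarkovChain ℝ
        open FunctionalRouter ℝ
    in
    ∀ {n} (P : Matrix (suc n)) (π : Vector Carrier (suc n)) →
    IsStochastic P → IsErgodic P → IsStationary P π → IsReversible P π →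
    (σ : Routers P) (χ₀ : Vector ℕ (suc n)) →
    ∀ (Ψ : Carrier) → IsΨ σ χ₀ Ψ →
    ∀ (w : Fin (suc n)) (T : ℕ) (γ : Carrier) → 0# < γ → γ < 1# / 2# →
    ∀ (τ : ℕ) → IsMixingTime P π γ τ →
    ∣ fromℕ (χ σ χ₀ T w) - μ P χ₀ T w ∣
      ≤ Ψ * ((2# * (1# - γ)) / (1# - 2# * γ)) * fromℕ τ * (π w / minimum π) * fromℕ (Δ P)
theorem3p1 {c} {ℓ₁} {ℓ₂} ℝ {n} P π stoch (irr , _) stat rev σ χ₀ Ψ isΨ w T γ _ γ<1/2 τ mix = begin
  ∣ fromℕ (χ σ χ₀ T w) - μ P χ₀ T w ∣
    ≤⟨ perturbation-bound P w (λ s → K * ‖ deviation w s ‖₁) (λ t u → fromℕ (χ σ χ₀ t u)) step T ⟩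
  partialSum (λ s → K * ‖ deviation w s ‖₁) T
    ≈⟨ *-distribˡ-partialSum K (λ s → ‖ deviation w s ‖₁) T ⟨
  K * partialSum (λ s → ‖ deviation w s ‖₁) T
    ≤⟨ *-monoˡ-≤ 0≤K (partialSum-‖deviation‖≤ γ<1/2 mix w T) ⟩
  K * (Γ * fromℕ τ)
    ≈⟨ solve 5 (λ a b c d e → (a :* b :* c) :* (d :* e) := a :* d :* e :* c :* b)
          refl Ψ (fromℕ (Δ P)) (π w / minimum π) Γ (fromℕ τ) ⟩
  Ψ * Γ * fromℕ τ * (π w / minimum π) * fromℕ (Δ P)    ∎
  where
  open CompleteOrderedField ℝ
  open MarkovChain ℝ
  open FunctionalRouter ℝ
  open OrderedField ℝ
  open Sums ℝ
  open Chain ℝ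
  open Stationary {P = P} {π} stoch stat
  open Reversible ℝ
  open Router ℝ
  Γ K : Carrier
  Γ = (2# * (1# - γ)) / (1# - 2# * γ)
  -- Gathers the factors that do not depend on time, so that they can be pulled out of the sum over
  -- `s`.
  K = Ψ * fromℕ (Δ P) * (π w / minimum π)
  0<π : ∀ u → 0# < π u
  0<π = stationary-positive irr stat rev
  0≤ΨΔ : 0# ≤ Ψ * fromℕ (Δ P)
  0≤ΨΔ = *-nonNegative (Ψ-nonNegative σ χ₀ isΨ w) (fromℕ-nonNegative (Δ P))
  0≤K : 0# ≤ K
  0≤K = *-nonNegative 0≤ΨΔ (*-nonNegative (proj₁ (0<π w)) (⁻¹-nonNegative (minimum-positive π 0<π)))
  step : ∀ t s → ∣ sum (λ u → stepError σ χ₀ t u * (P ^ s) u w) ∣ ≤ K * ‖ deviation w s ‖₁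
  step t s = begin
    ∣ sum (λ u → e u * (P ^ s) u w) ∣
      -- The errors at one time have total mass zero, so the constant `π w` may be subtracted from
      -- the column; without it the terms would not decay in `s`.
      ≈⟨ ∣∣-cong (sum-*-shift e (λ u → (P ^ s) u w) (π w) (sum-stepError σ χ₀ stoch t)) ⟩
    ∣ sum (λ u → e u * ((P ^ s) u w - π w)) ∣
      ≤⟨ ∣sum∣≤sum∣∣ (λ u → e u * ((P ^ s) u w - π w)) ⟩
    sum (λ u → ∣ e u * ((P ^ s) u w - π w) ∣)       ≤⟨ sum-mono-≤ {suc n} (λ u → begin
      ∣ e u * ((P ^ s) u w - π w) ∣
        ≈⟨ ∣x*y∣≈∣x∣*∣y∣ _ _ ⟩
      ∣ e u ∣ * ∣ (P ^ s) u w - π w ∣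
        ≤⟨ *-monoʳ-≤ (∣∣-nonNegative _) (∣stepError∣≤ σ χ₀ stoch (edge-sym stoch irr stat rev) isΨ t u) ⟩
      Ψ * fromℕ (Δ P) * ∣ (P ^ s) u w - π w ∣
        -- Passing from column `w` to row `w` makes the sum over `u` an ℓ¹ norm, which the mixing
        -- time controls.
        ≤⟨ *-monoˡ-≤ 0≤ΨΔ (column-deviation stoch irr stat rev s u w) ⟩
      Ψ * fromℕ (Δ P) * (π w / minimum π * ∣ deviation w s u ∣)                ≈⟨ *-assoc _ _ _ ⟨
      K * ∣ deviation w s u ∣                                                  ∎) ⟩
    sum (λ u → K * ∣ deviation w s u ∣)
      ≈⟨ *-distribˡ-sum K (λ u → ∣ deviation w s u ∣) ⟨
    K * ‖ deviation w s ‖₁                          ∎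
    where
    e : Vector Carrier (suc n)
    e = stepError σ χ₀ t
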